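{- Let $V_1,\dots,V_r$ be finite-dimensional real vector spaces, let $G_i\subset GL(V_i)$ ($1\le i\le r$) be finite groups, and let $k$ be an integer. If every $G_i$ is generated in codimension $k$, then the product group $G_1\times\dots\times G_r\subset GL(V_1\times\dots\times V_r)$ is generated in codimension $k$. Likewise, if every $G_i$ is strictly generated in codimension $k$, then $G_1\times\dots\times G_r$ is strictly generated in codimension $k$.
   Context: The product $G_1\times\dots\times G_r$ is regarded as a linear group acting factor-wise on $V_1\times\dots\times V_r$. For $g\in GL(V)$, $V^{\langle g\rangle}$ is the subspace of vectors fixed by $g$. A finite group $G\subset GL(V)$ is generated in codimension $k$ if it is generated by its elements $g$ with $\operatorname{codim}V^{\langle g\rangle}\le k$, and strictly generated in codimension $k$ if it is generated by its elements $g$ with $\operatorname{codim}V^{\langle g\rangle}=k$. -}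

module Defs where

open import Algebra.Bundles using (CommutativeMonoid; CommutativeRing; Group; Ring)
open import Algebra.Module.Bundles using (LeftModule)
import Algebra.Module.Morphism.Construct.Composition as Composition
import Algebra.Module.Morphism.Construct.Identity as Identity
open import Algebra.Module.Morphism.Structures using (module LeftModuleMorphisms)
import Algebra.Module.Properties.LeftModule as LeftModuleProperties
import Algebra.Properties.AbelianGroup as AbelianGroupProperties
import Algebra.Properties.CommutativeSemigroup as CommutativeSemigroupProperties
import Algebra.Properties.Monoid.Sum as MonoidSum
open import Data.Fin.Base using (Fin)
open import Data.Integer.Base as ℤ using (ℤ)
open import Data.Nat.Base as ℕ using (ℕ)
import Data.Nat.Properties as ℕₚ
open import Data.Product.Base using (∃; ∃-syntax; _×_; _,_; proj₁; proj₂)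
open import Data.Rational.Base as ℚ using (ℚ; 0ℚ; 1ℚ; ½)
import Data.Rational.Properties as ℚₚ
open import Data.Rational.Solver using (module +-*-Solver)
open import Data.Vec.Functional using (Vector)
open import Function.Bundles using (Inverse)
open import Level using (Level; _⊔_; 0ℓ) renaming (suc to lsuc)
open import Relation.Binary.Bundles using (Setoid)
import Relation.Binary.Construct.On as On
open import Relation.Binary.PropositionalEquality.Core using (_≡_; refl; sym; trans; cong; subst; subst₂)
open import Relation.Binary.PropositionalEquality.Properties using () renaming (setoid to ≡-setoid)
import Relation.Binary.Reasoning.Setoid as SetoidReasoning
open import Relation.Unary using (Pred; _∈_; _≐_)

-- x ~ x says that x is a Cauchy sequence (with its modulus as data), and for
-- Cauchy sequences x ~ y says that x - y tends to 0.  So _~_ is a partial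
-- equivalence relation, and ℝ is its domain.
infix 4 _~_
_~_ : (ℕ → ℚ) → (ℕ → ℚ) → Set
x ~ y = ∀ ε → 0ℚ ℚ.< ε → ∃[ N ] ∀ m n → N ℕ.≤ m → N ℕ.≤ n → ℚ.∣ x m ℚ.- y n ∣ ℚ.< ε

record ℝ : Set where
  constructor mkℝ
  field
    seq    : ℕ → ℚ
    cauchy : seq ~ seq

open ℝ public

infix 4 _≈ℝ_
record _≈ℝ_ (x y : ℝ) : Set where
  constructor mk≈
  field
    seq-~ : seq x ~ seq y

open _≈ℝ_ public

private
  Small : (ℕ → ℕ → ℚ) → Set
  Small d = ∀ ε → 0ℚ ℚ.< ε → ∃[ N ] ∀ m n → N ℕ.≤ m → N ℕ.≤ n → ℚ.∣ d m n ∣ ℚ.< ε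

  Bounded : (ℕ → ℕ → ℚ) → Set
  Bounded b = ∃[ B ] 0ℚ ℚ.< B × (∃[ N ] ∀ m n → N ℕ.≤ m → N ℕ.≤ n → ℚ.∣ b m n ∣ ℚ.< B)

  open +-*-Solver

  -- Abstract so that conversion checking never unfolds the convergence proofs.
  abstract
    small-≡ : ∀ {d e} → (∀ m n → d m n ≡ e m n) → Small d → Small e
    small-≡ d≡e sd ε ε>0 with sd ε ε>0
    ... | N , p = N , λ m n N≤m N≤n →
      subst (λ q → ℚ.∣ q ∣ ℚ.< ε) (d≡e m n) (p m n N≤m N≤n)

    ½-pos : ∀ {ε} → 0ℚ ℚ.< ε → 0ℚ ℚ.< ½ ℚ.* ε
    ½-pos {ε} ε>0 = subst (ℚ._< ½ ℚ.* ε) (ℚₚ.*-zeroʳ ½) (ℚₚ.*-monoʳ-<-pos ½ ε>0)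

    ½+½ : ∀ ε → ½ ℚ.* ε ℚ.+ ½ ℚ.* ε ≡ ε
    ½+½ ε = trans (sym (ℚₚ.*-distribʳ-+ ε ½ ½)) (ℚₚ.*-identityˡ ε)

    small-+ : ∀ {d e} → Small d → Small e → Small (λ m n → d m n ℚ.+ e m n)
    small-+ {d} {e} sd se ε ε>0 with sd (½ ℚ.* ε) (½-pos ε>0) | se (½ ℚ.* ε) (½-pos ε>0)
    ... | N₁ , p | N₂ , q = N₁ ℕ.⊔ N₂ , λ m n N≤m N≤n →
      ℚₚ.≤-<-trans (ℚₚ.∣p+q∣≤∣p∣+∣q∣ (d m n) (e m n))
        (subst (ℚ.∣ d m n ∣ ℚ.+ ℚ.∣ e m n ∣ ℚ.<_) (½+½ ε)
          (ℚₚ.+-mono-<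
            (p m n (ℕₚ.≤-trans (ℕₚ.m≤m⊔n N₁ N₂) N≤m) (ℕₚ.≤-trans (ℕₚ.m≤m⊔n N₁ N₂) N≤n))
            (q m n (ℕₚ.≤-trans (ℕₚ.m≤n⊔m N₁ N₂) N≤m) (ℕₚ.≤-trans (ℕₚ.m≤n⊔m N₁ N₂) N≤n))))

    small-neg : ∀ {d} → Small d → Small (λ m n → ℚ.- d m n)
    small-neg {d} sd ε ε>0 with sd ε ε>0
    ... | N , p = N , λ m n N≤m N≤n →
      subst (ℚ._< ε) (sym (ℚₚ.∣-p∣≡∣p∣ (d m n))) (p m n N≤m N≤n)

    small-* : ∀ {d b} → Small d → Bounded b → Small (λ m n → d m n ℚ.* b m n)
    small-* {d} {b} sd (B , B>0 , M , bM) ε ε>0 = N₁ ℕ.⊔ M , bound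
      where
      B-pos : ℚ.Positive B
      B-pos = ℚ.positive B>0
      B-nonZero : ℚ.NonZero B
      B-nonZero = ℚₚ.pos⇒nonZero B {{B-pos}}
      1/B : ℚ
      1/B = ℚ.1/_ B {{B-nonZero}}
      δ : ℚ
      δ = ε ℚ.* 1/B
      δ>0 : 0ℚ ℚ.< δ
      δ>0 = subst (ℚ._< δ) (ℚₚ.*-zeroˡ 1/B) (ℚₚ.*-monoˡ-<-pos 1/B {{ℚₚ.1/pos⇒pos B {{B-pos}}}} ε>0)
      δB≡ε : δ ℚ.* B ≡ ε
      δB≡ε = trans (ℚₚ.*-assoc ε 1/B B)
               (trans (cong (ε ℚ.*_) (ℚₚ.*-inverseˡ B {{B-nonZero}})) (ℚₚ.*-identityʳ ε))
      N₁ : ℕ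
      N₁ = proj₁ (sd δ δ>0)
      bound : ∀ m n → N₁ ℕ.⊔ M ℕ.≤ m → N₁ ℕ.⊔ M ℕ.≤ n → ℚ.∣ d m n ℚ.* b m n ∣ ℚ.< ε
      bound m n N≤m N≤n = subst₂ ℚ._<_ (sym (ℚₚ.∣p*q∣≡∣p∣*∣q∣ (d m n) (b m n))) δB≡ε
        (ℚₚ.≤-<-trans
          (ℚₚ.*-monoʳ-≤-nonNeg ℚ.∣ b m n ∣ {{ℚₚ.∣-∣-nonNeg (b m n)}}
            (ℚₚ.<⇒≤ (proj₂ (sd δ δ>0) m n
              (ℕₚ.≤-trans (ℕₚ.m≤m⊔n N₁ M) N≤m) (ℕₚ.≤-trans (ℕₚ.m≤m⊔n N₁ M) N≤n))))
          (ℚₚ.*-monoʳ-<-pos δ {{ℚ.positive δ>0}}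
            (bM m n (ℕₚ.≤-trans (ℕₚ.m≤n⊔m N₁ M) N≤m) (ℕₚ.≤-trans (ℕₚ.m≤n⊔m N₁ M) N≤n))))

    ~-sym : ∀ x y → x ~ y → y ~ x
    ~-sym x y x~y ε ε>0 with x~y ε ε>0
    ... | N , p = N , λ m n N≤m N≤n →
      subst (ℚ._< ε) (trans (sym (ℚₚ.∣-p∣≡∣p∣ (x n ℚ.- y m))) (cong ℚ.∣_∣
        (solve 2 (λ a b → :- (a :- b) := b :- a) refl (x n) (y m))))
        (p n m N≤n N≤m)

    ~-shift : ∀ x y z → x ~ y → y ~ z → Small (λ m n → (x m ℚ.- y n) ℚ.+ (y n ℚ.- z n))
    ~-shift x y z x~y y~z = small-+ x~y λ ε ε>0 →
      let N , p = y~z ε ε>0 in N , λ m n N≤m N≤n → p n n N≤n N≤n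

    ~-trans : ∀ x y z → x ~ y → y ~ z → x ~ z
    ~-trans x y z x~y y~z = small-≡
      (λ m n → solve 3 (λ a b c → (a :- b) :+ (b :- c) := a :- c) refl (x m) (y n) (z n))
      (~-shift x y z x~y y~z)

    ~-+ : ∀ x y u v → x ~ y → u ~ v → (λ n → x n ℚ.+ u n) ~ (λ n → y n ℚ.+ v n)
    ~-+ x y u v x~y u~v = small-≡
      (λ m n → solve 4 (λ a b c d → (a :- b) :+ (c :- d) := (a :+ c) :- (b :+ d)) refl
        (x m) (y n) (u m) (v n))
      (small-+ x~y u~v)

    ~-neg : ∀ x y → x ~ y → (λ n → ℚ.- x n) ~ (λ n → ℚ.- y n)
    ~-neg x y x~y = small-≡
      (λ m n → solve 2 (λ a b → :- (a :- b) := (:- a) :- (:- b)) refl (x m) (y n))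
      (small-neg x~y)

    eventuallyBounded : ∀ {u} → u ~ u → ∃[ B ] 0ℚ ℚ.< B × (∃[ N ] ∀ m → N ℕ.≤ m → ℚ.∣ u m ∣ ℚ.< B)
    eventuallyBounded {u} u~u with u~u 1ℚ (ℚₚ.positive⁻¹ 1ℚ)
    ... | N , p = 1ℚ ℚ.+ ℚ.∣ u N ∣
      , ℚₚ.+-mono-<-≤ {0ℚ} {1ℚ} (ℚₚ.positive⁻¹ 1ℚ) (ℚₚ.0≤∣p∣ (u N))
      , N , λ m N≤m → ℚₚ.≤-<-trans
          (subst (λ q → ℚ.∣ q ∣ ℚ.≤ ℚ.∣ u m ℚ.- u N ∣ ℚ.+ ℚ.∣ u N ∣)
            (solve 2 (λ a b → (a :- b) :+ b := a) refl (u m) (u N))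
            (ℚₚ.∣p+q∣≤∣p∣+∣q∣ (u m ℚ.- u N) (u N)))
          (ℚₚ.+-mono-<-≤ (p m N N≤m ℕₚ.≤-refl) (ℚₚ.≤-refl {ℚ.∣ u N ∣}))

    ~-* : ∀ x y u v → y ~ y → u ~ u → x ~ y → u ~ v → (λ n → x n ℚ.* u n) ~ (λ n → y n ℚ.* v n)
    ~-* x y u v y~y u~u x~y u~v = small-≡
      (λ m n → solve 4 (λ a b c d → (a :- b) :* c :+ (c :- d) :* b := a :* c :- b :* d) refl
        (x m) (y n) (u m) (v n))
      (small-+ (small-* x~y boundˡ) (small-* u~v boundʳ))
      where
      boundˡ : Bounded (λ m n → u m)
      boundˡ = let B , B>0 , N , p = eventuallyBounded u~u in B , B>0 , N , λ m n N≤m _ → p m N≤m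
      boundʳ : Bounded (λ m n → y n)
      boundʳ = let B , B>0 , N , p = eventuallyBounded y~y in B , B>0 , N , λ m n _ N≤n → p n N≤n

    ~-const : ∀ q → (λ _ → q) ~ (λ _ → q)
    ~-const q ε ε>0 = 0 , λ _ _ _ _ → subst (ℚ._< ε) (sym (cong ℚ.∣_∣ (ℚₚ.+-inverseʳ q))) ε>0

    pointwise : ∀ x y → (∀ n → seq x n ≡ seq y n) → x ≈ℝ y
    pointwise x y x≡y = mk≈ (small-≡ (λ m n → cong (λ q → seq x m ℚ.- q) (x≡y n)) (cauchy x))

infixl 6 _+ℝ_
infixl 7 _*ℝ_
infix  8 -ℝ_

_+ℝ_ : ℝ → ℝ → ℝ
x +ℝ y = mkℝ (λ n → seq x n ℚ.+ seq y n) (~-+ (seq x) (seq x) (seq y) (seq y) (cauchy x) (cauchy y))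

_*ℝ_ : ℝ → ℝ → ℝ
x *ℝ y = mkℝ (λ n → seq x n ℚ.* seq y n) (~-* (seq x) (seq x) (seq y) (seq y) (cauchy x) (cauchy y) (cauchy x) (cauchy y))

-ℝ_ : ℝ → ℝ
-ℝ x = mkℝ (λ n → ℚ.- seq x n) (~-neg (seq x) (seq x) (cauchy x))

0ℝ 1ℝ : ℝ
0ℝ = mkℝ (λ _ → 0ℚ) (~-const 0ℚ)
1ℝ = mkℝ (λ _ → 1ℚ) (~-const 1ℚ)

ℝ-commutativeRing : CommutativeRing 0ℓ 0ℓ
ℝ-commutativeRing = record
  { Carrier = ℝ ; _≈_ = _≈ℝ_ ; _+_ = _+ℝ_ ; _*_ = _*ℝ_ ; -_ = -ℝ_ ; 0# = 0ℝ ; 1# = 1ℝ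
  ; isCommutativeRing = record
    { isRing = record
      { +-isAbelianGroup = record
        { isGroup = record
          { isMonoid = record
            { isSemigroup = record
              { isMagma = record
                { isEquivalence = record
                  { refl  = λ {x} → mk≈ (cauchy x)
                  ; sym   = λ {x} {y} p → mk≈ (~-sym (seq x) (seq y) (seq-~ p))
                  ; trans = λ {x} {y} {z} p q → mk≈ (~-trans (seq x) (seq y) (seq z) (seq-~ p) (seq-~ q))
                  }
                ; ∙-cong = λ {x} {y} {u} {v} p q → mk≈ (~-+ (seq x) (seq y) (seq u) (seq v) (seq-~ p) (seq-~ q))
                }
              ; assoc = λ x y z → pointwise (x +ℝ y +ℝ z) (x +ℝ (y +ℝ z)) λ n → ℚₚ.+-assoc (seq x n) (seq y n) (seq z n)
              }
            ; identity = (λ x → pointwise (0ℝ +ℝ x) x λ n → ℚₚ.+-identityˡ (seq x n))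
                       , (λ x → pointwise (x +ℝ 0ℝ) x λ n → ℚₚ.+-identityʳ (seq x n))
            }
          ; inverse = (λ x → pointwise (-ℝ x +ℝ x) 0ℝ λ n → ℚₚ.+-inverseˡ (seq x n))
                    , (λ x → pointwise (x +ℝ -ℝ x) 0ℝ λ n → ℚₚ.+-inverseʳ (seq x n))
          ; ⁻¹-cong = λ {x} {y} p → mk≈ (~-neg (seq x) (seq y) (seq-~ p))
          }
        ; comm = λ x y → pointwise (x +ℝ y) (y +ℝ x) λ n → ℚₚ.+-comm (seq x n) (seq y n)
        }
      ; *-cong = λ {x} {y} {u} {v} p q →
          mk≈ (~-* (seq x) (seq y) (seq u) (seq v) (cauchy y) (cauchy u) (seq-~ p) (seq-~ q))
      ; *-assoc = λ x y z → pointwise (x *ℝ y *ℝ z) (x *ℝ (y *ℝ z)) λ n → ℚₚ.*-assoc (seq x n) (seq y n) (seq z n)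
      ; *-identity = (λ x → pointwise (1ℝ *ℝ x) x λ n → ℚₚ.*-identityˡ (seq x n))
                   , (λ x → pointwise (x *ℝ 1ℝ) x λ n → ℚₚ.*-identityʳ (seq x n))
      ; distrib = (λ x y z → pointwise (x *ℝ (y +ℝ z)) (x *ℝ y +ℝ x *ℝ z)
                    λ n → ℚₚ.*-distribˡ-+ (seq x n) (seq y n) (seq z n))
                , (λ x y z → pointwise ((y +ℝ z) *ℝ x) (y *ℝ x +ℝ z *ℝ x)
                    λ n → ℚₚ.*-distribʳ-+ (seq x n) (seq y n) (seq z n))
      }
    ; *-comm = λ x y → pointwise (x *ℝ y) (y *ℝ x) λ n → ℚₚ.*-comm (seq x n) (seq y n)
    }
  }

ℝ-ring : Ring 0ℓ 0ℓ
ℝ-ring = CommutativeRing.ring ℝ-commutativeRing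

private
  variable
    a b c m ℓ p : Level
    K : Ring a b

-- The linear algebra is written for modules over any ring K and used for
-- K = ℝ-ring, where a module is a vector space; a Basis is a free basis.
module _ {K : Ring a b} (V : LeftModule K m ℓ) where
  private module K = Ring K
  open LeftModule V

  linearCombination : ∀ {n} → Vector K.Carrier n → Vector Carrierᴹ n → Carrierᴹ
  linearCombination x e = MonoidSum.sum +ᴹ-monoid (λ j → x j *ₗ e j)

  record Basis (n : ℕ) : Set (a ⊔ b ⊔ m ⊔ ℓ) where
    field
      vectors     : Vector Carrierᴹ n
      spanning    : ∀ v → ∃[ x ] v ≈ᴹ linearCombination x vectors
      independent : ∀ x → linearCombination x vectors ≈ᴹ 0ᴹ → ∀ j → x j K.≈ K.0#

  FiniteDimensional : Set (a ⊔ b ⊔ m ⊔ ℓ)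
  FiniteDimensional = ∃[ n ] Basis n

  record Subspace p : Set (a ⊔ m ⊔ ℓ ⊔ lsuc p) where
    field
      Member    : Pred Carrierᴹ p
      resp-≈    : ∀ {u v} → u ≈ᴹ v → u ∈ Member → v ∈ Member
      0-closed  : 0ᴹ ∈ Member
      +-closed  : ∀ {u v} → u ∈ Member → v ∈ Member → (u +ᴹ v) ∈ Member
      *ₗ-closed : ∀ x {v} → v ∈ Member → (x *ₗ v) ∈ Member

module _ {K : Ring a b} (V : LeftModule K m ℓ) (W : Subspace V p) where
  open LeftModule V
  open Subspace W

  private
    module K = Ring K
    open LeftModuleProperties V using (inverseʳ-uniqueᴹ)
    open AbelianGroupProperties +ᴹ-abelianGroup using (⁻¹-∙-comm; ⁻¹-anti-homo‿-)
    open CommutativeSemigroupProperties (CommutativeMonoid.commutativeSemigroup +ᴹ-commutativeMonoid)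
      using (interchange)
    open SetoidReasoning ≈ᴹ-setoid

    infix 4 _≡W_
    _≡W_ : Carrierᴹ → Carrierᴹ → Set p
    u ≡W v = (u +ᴹ -ᴹ v) ∈ Member

    -1*v≈-v : ∀ v → (K.- K.1#) *ₗ v ≈ᴹ -ᴹ v
    -1*v≈-v v = inverseʳ-uniqueᴹ v ((K.- K.1#) *ₗ v) (begin
      v +ᴹ (K.- K.1#) *ₗ v         ≈⟨ +ᴹ-congʳ (≈ᴹ-sym (*ₗ-identityˡ v)) ⟩
      K.1# *ₗ v +ᴹ (K.- K.1#) *ₗ v   ≈⟨ ≈ᴹ-sym (*ₗ-distribʳ v K.1# (K.- K.1#)) ⟩
      (K.1# K.+ (K.- K.1#)) *ₗ v      ≈⟨ *ₗ-congʳ (K.-‿inverseʳ K.1#) ⟩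
      K.0# *ₗ v                   ≈⟨ *ₗ-zeroˡ v ⟩
      0ᴹ                        ∎)

    a*-v≈-a*v : ∀ a v → a *ₗ (-ᴹ v) ≈ᴹ -ᴹ (a *ₗ v)
    a*-v≈-a*v a v = inverseʳ-uniqueᴹ (a *ₗ v) (a *ₗ (-ᴹ v)) (begin
      a *ₗ v +ᴹ a *ₗ (-ᴹ v)     ≈⟨ ≈ᴹ-sym (*ₗ-distribˡ a v (-ᴹ v)) ⟩
      a *ₗ (v +ᴹ -ᴹ v)          ≈⟨ *ₗ-congˡ (-ᴹ‿inverseʳ v) ⟩
      a *ₗ 0ᴹ                   ≈⟨ *ₗ-zeroʳ a ⟩
      0ᴹ                        ∎)

    neg-closed : ∀ {v} → v ∈ Member → (-ᴹ v) ∈ Member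
    neg-closed {v} v∈W = resp-≈ (-1*v≈-v v) (*ₗ-closed (K.- K.1#) v∈W)

    ≈⇒≡W : ∀ {u v} → u ≈ᴹ v → u ≡W v
    ≈⇒≡W {u} {v} u≈v = resp-≈ (begin
      0ᴹ         ≈⟨ ≈ᴹ-sym (-ᴹ‿inverseʳ v) ⟩
      v +ᴹ -ᴹ v  ≈⟨ +ᴹ-congʳ (≈ᴹ-sym u≈v) ⟩
      u +ᴹ -ᴹ v  ∎) 0-closed

    ≡W-sym : ∀ {u v} → u ≡W v → v ≡W u
    ≡W-sym {u} {v} u≡v = resp-≈ (⁻¹-anti-homo‿- u v) (neg-closed u≡v)

    ≡W-trans : ∀ {u v w} → u ≡W v → v ≡W w → u ≡W w
    ≡W-trans {u} {v} {w} u≡v v≡w = resp-≈ (begin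
      (u +ᴹ -ᴹ v) +ᴹ (v +ᴹ -ᴹ w)  ≈⟨ +ᴹ-assoc u (-ᴹ v) (v +ᴹ -ᴹ w) ⟩
      u +ᴹ (-ᴹ v +ᴹ (v +ᴹ -ᴹ w))  ≈⟨ +ᴹ-congˡ (≈ᴹ-sym (+ᴹ-assoc (-ᴹ v) v (-ᴹ w))) ⟩
      u +ᴹ ((-ᴹ v +ᴹ v) +ᴹ -ᴹ w)  ≈⟨ +ᴹ-congˡ (+ᴹ-congʳ (-ᴹ‿inverseˡ v)) ⟩
      u +ᴹ (0ᴹ +ᴹ -ᴹ w)           ≈⟨ +ᴹ-congˡ (+ᴹ-identityˡ (-ᴹ w)) ⟩
      u +ᴹ -ᴹ w                   ∎) (+-closed u≡v v≡w)

    ≡W-+ : ∀ {u u′ v v′} → u ≡W u′ → v ≡W v′ → (u +ᴹ v) ≡W (u′ +ᴹ v′)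
    ≡W-+ {u} {u′} {v} {v′} u≡u′ v≡v′ = resp-≈ (begin
      (u +ᴹ -ᴹ u′) +ᴹ (v +ᴹ -ᴹ v′)  ≈⟨ interchange u (-ᴹ u′) v (-ᴹ v′) ⟩
      (u +ᴹ v) +ᴹ (-ᴹ u′ +ᴹ -ᴹ v′)  ≈⟨ +ᴹ-congˡ (⁻¹-∙-comm u′ v′) ⟩
      (u +ᴹ v) +ᴹ -ᴹ (u′ +ᴹ v′)     ∎) (+-closed u≡u′ v≡v′)

    ≡W-neg : ∀ {u v} → u ≡W v → (-ᴹ u) ≡W (-ᴹ v)
    ≡W-neg {u} {v} u≡v = resp-≈ (≈ᴹ-sym (⁻¹-∙-comm u (-ᴹ v))) (neg-closed u≡v)

    ≡W-*ₗ : ∀ {a b u v} → a K.≈ b → u ≡W v → (a *ₗ u) ≡W (b *ₗ v)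
    ≡W-*ₗ {a} {b} {u} {v} a≈b u≡v = resp-≈ (begin
      a *ₗ (u +ᴹ -ᴹ v)        ≈⟨ *ₗ-distribˡ a u (-ᴹ v) ⟩
      a *ₗ u +ᴹ a *ₗ (-ᴹ v)   ≈⟨ +ᴹ-congˡ (*ₗ-congʳ a≈b) ⟩
      a *ₗ u +ᴹ b *ₗ (-ᴹ v)   ≈⟨ +ᴹ-congˡ (a*-v≈-a*v b v) ⟩
      a *ₗ u +ᴹ -ᴹ (b *ₗ v)   ∎) (*ₗ-closed a u≡v)

  -- Same vectors and operations as V; equality is congruence modulo W.
  quotientSpace : LeftModule K m p
  quotientSpace = record
    { Carrierᴹ = Carrierᴹ
    ; _≈ᴹ_ = λ u v → (u +ᴹ -ᴹ v) ∈ Member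
    ; _+ᴹ_ = _+ᴹ_ ; _*ₗ_ = _*ₗ_ ; 0ᴹ = 0ᴹ ; -ᴹ_ = -ᴹ_
    ; isLeftModule = record
      { isLeftSemimodule = record
        { +ᴹ-isCommutativeMonoid = record
          { isMonoid = record
            { isSemigroup = record
              { isMagma = record
                { isEquivalence = record { refl = ≈⇒≡W ≈ᴹ-refl ; sym = ≡W-sym ; trans = ≡W-trans }
                ; ∙-cong = ≡W-+
                }
              ; assoc = λ u v w → ≈⇒≡W (+ᴹ-assoc u v w)
              }
            ; identity = (λ v → ≈⇒≡W (+ᴹ-identityˡ v)) , (λ v → ≈⇒≡W (+ᴹ-identityʳ v))
            }
          ; comm = λ u v → ≈⇒≡W (+ᴹ-comm u v)
          }
        ; isPreleftSemimodule = record
          { *ₗ-cong      = ≡W-*ₗ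
          ; *ₗ-zeroˡ     = λ v → ≈⇒≡W (*ₗ-zeroˡ v)
          ; *ₗ-distribʳ  = λ v a b → ≈⇒≡W (*ₗ-distribʳ v a b)
          ; *ₗ-identityˡ = λ v → ≈⇒≡W (*ₗ-identityˡ v)
          ; *ₗ-assoc     = λ a b v → ≈⇒≡W (*ₗ-assoc a b v)
          ; *ₗ-zeroʳ     = λ a → ≈⇒≡W (*ₗ-zeroʳ a)
          ; *ₗ-distribˡ  = λ a u v → ≈⇒≡W (*ₗ-distribˡ a u v)
          }
        }
      ; -ᴹ‿cong = ≡W-neg
      ; -ᴹ‿inverse = (λ v → ≈⇒≡W (-ᴹ‿inverseˡ v)) , (λ v → ≈⇒≡W (-ᴹ‿inverseʳ v))
      }
    }

-- codim W = dim V/W.  It is a relation rather than a function because a basis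
-- of V/W cannot be computed from an arbitrary subspace.
HasCodimension : {K : Ring a b} (V : LeftModule K m ℓ) → Subspace V p → ℕ → Set (a ⊔ b ⊔ m ⊔ p)
HasCodimension V W n = Basis (quotientSpace V W) n

productSpace : ∀ {r} → (Fin r → LeftModule K m ℓ) → LeftModule K m ℓ
productSpace {r = r} V = record
  { Carrierᴹ = ∀ i → V.Carrierᴹ i
  ; _≈ᴹ_ = λ u v → ∀ i → V._≈ᴹ_ i (u i) (v i)
  ; _+ᴹ_ = λ u v i → V._+ᴹ_ i (u i) (v i)
  ; _*ₗ_ = λ a v i → V._*ₗ_ i a (v i)
  ; 0ᴹ   = λ i → V.0ᴹ i
  ; -ᴹ_  = λ v i → V.-ᴹ_ i (v i)
  ; isLeftModule = record
    { isLeftSemimodule = record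
      { +ᴹ-isCommutativeMonoid = record
        { isMonoid = record
          { isSemigroup = record
            { isMagma = record
              { isEquivalence = record
                { refl  = λ i → V.≈ᴹ-refl i
                ; sym   = λ p i → V.≈ᴹ-sym i (p i)
                ; trans = λ p q i → V.≈ᴹ-trans i (p i) (q i)
                }
              ; ∙-cong = λ p q i → V.+ᴹ-cong i (p i) (q i)
              }
            ; assoc = λ u v w i → V.+ᴹ-assoc i (u i) (v i) (w i)
            }
          ; identity = (λ v i → V.+ᴹ-identityˡ i (v i)) , (λ v i → V.+ᴹ-identityʳ i (v i))
          }
        ; comm = λ u v i → V.+ᴹ-comm i (u i) (v i)
        }
      ; isPreleftSemimodule = record
        { *ₗ-cong      = λ p q i → V.*ₗ-cong i p (q i)
        ; *ₗ-zeroˡ     = λ v i → V.*ₗ-zeroˡ i (v i)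
        ; *ₗ-distribʳ  = λ v a b i → V.*ₗ-distribʳ i (v i) a b
        ; *ₗ-identityˡ = λ v i → V.*ₗ-identityˡ i (v i)
        ; *ₗ-assoc     = λ a b v i → V.*ₗ-assoc i a b (v i)
        ; *ₗ-zeroʳ     = λ a i → V.*ₗ-zeroʳ i a
        ; *ₗ-distribˡ  = λ a u v i → V.*ₗ-distribˡ i a (u i) (v i)
        }
      }
    ; -ᴹ‿cong = λ p i → V.-ᴹ‿cong i (p i)
    ; -ᴹ‿inverse = (λ v i → V.-ᴹ‿inverseˡ i (v i)) , (λ v i → V.-ᴹ‿inverseʳ i (v i))
    }
  }
  where module V (i : Fin r) = LeftModule (V i)

module _ (G : Group c ℓ) where
  open Group G

  record Subgroup p : Set (c ⊔ ℓ ⊔ lsuc p) where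
    field
      Member    : Pred Carrier p
      resp-≈    : ∀ {x y} → x ≈ y → x ∈ Member → y ∈ Member
      ε-closed  : ε ∈ Member
      ∙-closed  : ∀ {x y} → x ∈ Member → y ∈ Member → (x ∙ y) ∈ Member
      ⁻¹-closed : ∀ {x} → x ∈ Member → (x ⁻¹) ∈ Member

  data Generated (S : Pred Carrier p) : Pred Carrier (c ⊔ ℓ ⊔ p) where
    gen  : ∀ {x} → x ∈ S → x ∈ Generated S
    one  : ε ∈ Generated S
    mul  : ∀ {x y} → x ∈ Generated S → y ∈ Generated S → (x ∙ y) ∈ Generated S
    inv  : ∀ {x} → x ∈ Generated S → (x ⁻¹) ∈ Generated S
    resp : ∀ {x y} → x ≈ y → x ∈ Generated S → y ∈ Generated S

  Finite : ∀ {p} → Subgroup p → Set (c ⊔ ℓ ⊔ p)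
  Finite {p} H = ∃[ n ] Inverse elements (≡-setoid (Fin n))
    where
    elements : Setoid (c ⊔ p) ℓ
    elements = On.setoid {B = ∃ (Subgroup.Member H)} setoid proj₁

module _ {K : Ring a b} (V : LeftModule K m ℓ) where
  open LeftModule V
  open LeftModuleMorphisms rawLeftModule rawLeftModule

  record LinearAutomorphism : Set (a ⊔ m ⊔ ℓ) where
    field
      apply                   : Carrierᴹ → Carrierᴹ
      isLeftModuleIsomorphism : IsLeftModuleIsomorphism apply

    open IsLeftModuleIsomorphism isLeftModuleIsomorphism public

  open LinearAutomorphism

  private
    isHomomorphism : (f : Carrierᴹ → Carrierᴹ) →
      (∀ {u v} → u ≈ᴹ v → f u ≈ᴹ f v) →
      (∀ u v → f (u +ᴹ v) ≈ᴹ f u +ᴹ f v) →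
      f 0ᴹ ≈ᴹ 0ᴹ →
      (∀ v → f (-ᴹ v) ≈ᴹ -ᴹ f v) →
      (∀ a v → f (a *ₗ v) ≈ᴹ a *ₗ f v) →
      IsLeftModuleHomomorphism f
    isHomomorphism f f-cong f-+ f-0 f-neg f-* = record
      { +ᴹ-isGroupHomomorphism = record
        { isMonoidHomomorphism = record
          { isMagmaHomomorphism = record { isRelHomomorphism = record { cong = f-cong } ; homo = f-+ }
          ; ε-homo = f-0
          }
        ; ⁻¹-homo = f-neg
        }
      ; *ₗ-homo = f-*
      }

    module _ (g : LinearAutomorphism) where
      back : Carrierᴹ → Carrierᴹ
      back v = proj₁ (surjective g v)

      apply-back : ∀ v → apply g (back v) ≈ᴹ v
      apply-back v = proj₂ (surjective g v) ≈ᴹ-refl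

      back-unique : ∀ {u v} → apply g u ≈ᴹ v → back v ≈ᴹ u
      back-unique {u} {v} gu≈v = injective g (≈ᴹ-trans (apply-back v) (≈ᴹ-sym gu≈v))

      back-isHomomorphism : IsLeftModuleHomomorphism back
      back-isHomomorphism = isHomomorphism back
        (λ {u} {v} u≈v → back-unique (≈ᴹ-trans (apply-back v) (≈ᴹ-sym u≈v)))
        (λ u v → back-unique (≈ᴹ-trans (+ᴹ-homo g (back u) (back v)) (+ᴹ-cong (apply-back u) (apply-back v))))
        (back-unique (0ᴹ-homo g))
        (λ v → back-unique (≈ᴹ-trans (-ᴹ-homo g (back v)) (-ᴹ‿cong (apply-back v))))
        (λ a v → back-unique (≈ᴹ-trans (*ₗ-homo g a (back v)) (*ₗ-congˡ (apply-back v))))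

      back-isIsomorphism : IsLeftModuleIsomorphism back
      back-isIsomorphism = record
        { isLeftModuleMonomorphism = record
          { isLeftModuleHomomorphism = back-isHomomorphism
          ; injective = λ {u} {v} bu≈bv →
              ≈ᴹ-trans (≈ᴹ-sym (apply-back u)) (≈ᴹ-trans (⟦⟧-cong g bu≈bv) (apply-back v))
          }
        ; surjective = λ v → apply g v , λ w≈gv → back-unique (≈ᴹ-sym w≈gv)
        }

  GL : Group (a ⊔ m ⊔ ℓ) (m ⊔ ℓ)
  GL = record
    { Carrier = LinearAutomorphism
    ; _≈_ = λ g h → ∀ v → apply g v ≈ᴹ apply h v
    ; _∙_ = λ g h → record
        { apply = λ v → apply g (apply h v)
        ; isLeftModuleIsomorphism = Composition.isLeftModuleIsomorphism ≈ᴹ-trans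
            (isLeftModuleIsomorphism h) (isLeftModuleIsomorphism g)
        }
    ; ε = record
        { apply = λ v → v
        ; isLeftModuleIsomorphism = Identity.isLeftModuleIsomorphism rawLeftModule ≈ᴹ-refl
        }
    ; _⁻¹ = λ g → record { apply = back g ; isLeftModuleIsomorphism = back-isIsomorphism g }
    ; isGroup = record
      { isMonoid = record
        { isSemigroup = record
          { isMagma = record
            { isEquivalence = record
              { refl  = λ v → ≈ᴹ-refl
              ; sym   = λ p v → ≈ᴹ-sym (p v)
              ; trans = λ p q v → ≈ᴹ-trans (p v) (q v)
              }
            ; ∙-cong = λ {g} {g′} {h} {h′} p q v → ≈ᴹ-trans (⟦⟧-cong g (q v)) (p (apply h′ v))
            }
          ; assoc = λ g h k v → ≈ᴹ-refl
          }
        ; identity = (λ g v → ≈ᴹ-refl) , (λ g v → ≈ᴹ-refl)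
        }
      ; inverse = (λ g v → back-unique g ≈ᴹ-refl) , (λ g v → apply-back g v)
      ; ⁻¹-cong = λ {g} {h} p v → back-unique g (≈ᴹ-trans (p (back h v)) (apply-back h v))
      }
    }

  fixedSubspace : LinearAutomorphism → Subspace V ℓ
  fixedSubspace g = record
    { Member    = λ v → apply g v ≈ᴹ v
    ; resp-≈    = λ u≈v gu≈u → ≈ᴹ-trans (⟦⟧-cong g (≈ᴹ-sym u≈v)) (≈ᴹ-trans gu≈u u≈v)
    ; 0-closed  = 0ᴹ-homo g
    ; +-closed  = λ gu≈u gv≈v → ≈ᴹ-trans (+ᴹ-homo g _ _) (+ᴹ-cong gu≈u gv≈v)
    ; *ₗ-closed = λ a gv≈v → ≈ᴹ-trans (*ₗ-homo g a _) (*ₗ-congˡ gv≈v)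
    }

  -- A subgroup of GL(V); finiteness is the separate predicate Finite GL.
  LinearGroup : ∀ p → Set (a ⊔ m ⊔ ℓ ⊔ lsuc p)
  LinearGroup p = Subgroup GL p

  -- n ranges over the (natural) codimensions of fixed subspaces, whereas the
  -- bound k may be any integer, so no element qualifies when k is negative.
  GeneratedInCodimension : ℤ → LinearGroup p → Set (a ⊔ b ⊔ m ⊔ ℓ ⊔ p)
  GeneratedInCodimension k G = Member ≐ Generated GL λ g →
    g ∈ Member × (∃[ n ] HasCodimension V (fixedSubspace g) n × ℤ.+ n ℤ.≤ k)
    where open Subgroup G

  StrictlyGeneratedInCodimension : ℤ → LinearGroup p → Set (a ⊔ b ⊔ m ⊔ ℓ ⊔ p)
  StrictlyGeneratedInCodimension k G = Member ≐ Generated GL λ g →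
    g ∈ Member × (∃[ n ] HasCodimension V (fixedSubspace g) n × ℤ.+ n ≡ k)
    where open Subgroup G

module _ {K : Ring a b} {r : ℕ} (V : Fin r → LeftModule K m ℓ) where
  private
    module V (i : Fin r) = LeftModule (V i)
    module GL (i : Fin r) = Group (GL (V i))
    module GLΠ = Group (GL (productSpace V))
  open LinearAutomorphism

  productAutomorphism : (∀ i → LinearAutomorphism (V i)) → LinearAutomorphism (productSpace V)
  productAutomorphism g = record
    { apply = λ v i → apply (g i) (v i)
    ; isLeftModuleIsomorphism = record
      { isLeftModuleMonomorphism = record
        { isLeftModuleHomomorphism = record
          { +ᴹ-isGroupHomomorphism = record
            { isMonoidHomomorphism = record
              { isMagmaHomomorphism = record
                { isRelHomomorphism = record { cong = λ p i → ⟦⟧-cong (g i) (p i) }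
                ; homo = λ u v i → +ᴹ-homo (g i) (u i) (v i)
                }
              ; ε-homo = λ i → 0ᴹ-homo (g i)
              }
            ; ⁻¹-homo = λ v i → -ᴹ-homo (g i) (v i)
            }
          ; *ₗ-homo = λ a v i → *ₗ-homo (g i) a (v i)
          }
        ; injective = λ p i → injective (g i) (p i)
        }
      ; surjective = λ v → (λ i → proj₁ (surjective (g i) (v i)))
                         , (λ p i → proj₂ (surjective (g i) (v i)) (p i))
      }
    }

  -- The image of G₁ × … × G_r in GL(V₁ × … × V_r).
  productGroup : (∀ i → LinearGroup (V i) p) → LinearGroup (productSpace V) (a ⊔ m ⊔ ℓ ⊔ p)
  productGroup G = record
    { Member    = λ g → ∃[ h ] (∀ i → h i ∈ Member i) × g GLΠ.≈ productAutomorphism h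
    ; resp-≈    = λ { {g} {g′} g≈g′ (h , h∈G , g≈h) →
        h , h∈G , GLΠ.trans {g′} {g} {productAutomorphism h} (GLΠ.sym {g} {g′} g≈g′) g≈h }
    ; ε-closed  = (λ i → GL.ε i) , (λ i → ε-closed i) , (λ v i → V.≈ᴹ-refl i)
    ; ∙-closed  = λ { {g} {g′} (h , h∈G , g≈h) (h′ , h′∈G , g′≈h′) →
        (λ i → GL._∙_ i (h i) (h′ i)) , (λ i → ∙-closed i (h∈G i) (h′∈G i)) ,
        GLΠ.∙-cong {g} {productAutomorphism h} {g′} {productAutomorphism h′} g≈h g′≈h′ }
    ; ⁻¹-closed = λ { {g} (h , h∈G , g≈h) →
        (λ i → GL._⁻¹ i (h i)) , (λ i → ⁻¹-closed i (h∈G i)) ,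
        GLΠ.⁻¹-cong {g} {productAutomorphism h} g≈h }
    }
    where open module G (i : Fin r) = Subgroup (G i)

RealVectorSpace : ∀ m ℓ → Set (lsuc (m ⊔ ℓ))
RealVectorSpace m ℓ = LeftModule ℝ-ring m ℓ

{-# OPTIONS --safe #-}
-- Write ιᵢ(g) for the automorphism acting as g on the i-th factor and trivially
-- on the others.  Its fixed space is the preimage of V_i^⟨g⟩ under the i-th
-- projection, so a basis of V_i/V_i^⟨g⟩, extended by zero, is a basis of the
-- quotient of the product, and ιᵢ preserves the codimension.  As ιᵢ is a
-- homomorphism, it carries generators of Gᵢ to elements of the same codimension
-- that generate ιᵢ(Gᵢ), and every element of the product group is a product of
-- elements ιᵢ(hᵢ).
module Submission where

open import Defs
open import Algebra.Bundles using (Group; Ring)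
open import Algebra.Module.Bundles using (LeftModule)
open import Data.Empty using (⊥-elim)
open import Data.Fin.Base using (Fin; zero; suc)
open import Data.Fin.Properties using (_≟_)
open import Data.Integer.Base using (ℤ)
import Data.Integer.Base as ℤ
open import Data.List.Base using (List; []; _∷_; allFin)
open import Data.List.Membership.Propositional using (_∉_)
open import Data.List.Membership.Propositional.Properties using (∈-allFin)
open import Data.List.Relation.Unary.Any using (here; there)
open import Data.Nat.Base using (ℕ; zero; suc)
open import Data.Product.Base using (_×_; _,_; proj₁; proj₂; ∃-syntax)
open import Data.Vec.Functional using (Vector)
open import Function.Base using (_∘_)
open import Level using (Level)
open import Relation.Binary.PropositionalEquality using (_≡_; refl; sym; cong; subst)
open import Relation.Nullary.Decidable using (yes; no)
open import Relation.Unary using (Pred; _∈_; _⊆_)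

private
  variable
    a b c m ℓ p q : Level
    r : ℕ
    K : Ring a b

-- All later case splits on `i ≟ j` have this same form, so that each one makes `replace z i x j`
-- compute in both branches.
replace : {A : Fin r → Set a} → (∀ j → A j) → (i : Fin r) → A i → ∀ j → A j
replace z i x j with i ≟ j
... | yes refl = x
... | no  _    = z j

replace-all : {A : Fin r → Set a} (P : ∀ j → Pred (A j) p) {z : ∀ j → A j} (i : Fin r) {x : A i} →
  (∀ j → z j ∈ P j) → x ∈ P i → ∀ j → replace z i x j ∈ P j
replace-all P i z∈P x∈P j with i ≟ j
... | yes refl = x∈P
... | no  _    = z∈P j

module _ (G : Group c ℓ) where
  open Group G using (Carrier)

  -- Supplies the easy inclusion in `≐`: generators chosen inside a group generate nothing beyond
  -- it.
  Generated⊆Subgroup : (H : Subgroup G q) {S : Pred Carrier p} →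
    S ⊆ Subgroup.Member H → Generated G S ⊆ Subgroup.Member H
  Generated⊆Subgroup H S⊆H (gen x∈S)    = S⊆H x∈S
  Generated⊆Subgroup H S⊆H one          = Subgroup.ε-closed H
  Generated⊆Subgroup H S⊆H (mul x∈ y∈)  =
    Subgroup.∙-closed H (Generated⊆Subgroup H S⊆H x∈) (Generated⊆Subgroup H S⊆H y∈)
  Generated⊆Subgroup H S⊆H (inv x∈)     = Subgroup.⁻¹-closed H (Generated⊆Subgroup H S⊆H x∈)
  Generated⊆Subgroup H S⊆H (resp x≈y x∈) = Subgroup.resp-≈ H x≈y (Generated⊆Subgroup H S⊆H x∈)

module _ {K : Ring a b} (V : LeftModule K m ℓ) where
  private module GL = Group (GL V)

  FixedCodimension : Pred ℕ q → Pred GL.Carrier _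
  FixedCodimension Q g = ∃[ n ] HasCodimension V (fixedSubspace V g) n × n ∈ Q

  -- The condition on the codimension is left open as `Q`; taking `ℤ.+ n ℤ.≤ k` or `ℤ.+ n ≡ k`
  -- recovers the generating sets of the two notions.
  codimensionGenerators : LinearGroup V p → Pred ℕ q → Pred GL.Carrier _
  codimensionGenerators G Q g = g ∈ Subgroup.Member G × g ∈ FixedCodimension Q

module _ {K : Ring a b} (V : Fin r → LeftModule K m ℓ) where
  private
    module K = Ring K
    module V (i : Fin r) = LeftModule (V i)
    module GL (i : Fin r) = Group (GL (V i))
    module GLΠ = Group (GL (productSpace V))
  open LinearAutomorphism

  -- Product operations are componentwise by definition, so the equality is propositional and can be
  -- used with `subst`.
  linearCombination-component : ∀ {n} (x : Vector K.Carrier n)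
    (e : Vector (LeftModule.Carrierᴹ (productSpace V)) n) j →
    linearCombination (productSpace V) x e j ≡ linearCombination (V j) x (λ k → e k j)
  linearCombination-component {zero}  x e j = refl
  linearCombination-component {suc n} x e j =
    cong (V._+ᴹ_ j (V._*ₗ_ j (x zero) (e zero j))) (linearCombination-component (x ∘ suc) (e ∘ suc) j)

  injectVector : ∀ i → V.Carrierᴹ i → LeftModule.Carrierᴹ (productSpace V)
  injectVector = replace V.0ᴹ

  injectAutomorphism : ∀ i → LinearAutomorphism (V i) → LinearAutomorphism (productSpace V)
  injectAutomorphism i g = productAutomorphism V (replace GL.ε i g)

  injectAutomorphism-codimension : ∀ i (g : LinearAutomorphism (V i)) {n} →
    HasCodimension (V i) (fixedSubspace (V i) g) n →
    HasCodimension (productSpace V) (fixedSubspace (productSpace V) (injectAutomorphism i g)) n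
  injectAutomorphism-codimension i g {n} B = record
    { vectors     = E
    -- Components other than `i` are fixed anyway, so the coordinates of `v i` modulo the fixed
    -- space of `g` serve for all of `v`.
    ; spanning    = λ v → proj₁ (spanning (v i)) , λ j →
        subst (λ w → FixedAt j (V._+ᴹ_ j (v j) (V.-ᴹ_ j w)))
          (sym (linearCombination-component _ E j)) (span-at v j)
    -- A relation modulo the fixed space, read in component `i`, is a relation among the original
    -- `vectors`.
    ; independent = λ x p → independent-at x i refl
        (subst (λ w → FixedAt i (V._+ᴹ_ i w (V.-ᴹ_ i (V.0ᴹ i))))
          (linearCombination-component x E i) (p i))
    }
    where
    open Basis B

    E : Vector (LeftModule.Carrierᴹ (productSpace V)) n
    E k = injectVector i (vectors k)

    -- The fixed space of `injectAutomorphism i g` is cut out by this condition at every `j`; for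
    -- `j` other than `i` it holds trivially.
    FixedAt : ∀ j → V.Carrierᴹ j → Set ℓ
    FixedAt j w = V._≈ᴹ_ j (apply (replace GL.ε i g j) w) w

    span-at : ∀ v j → FixedAt j (V._+ᴹ_ j (v j)
      (V.-ᴹ_ j (linearCombination (V j) (proj₁ (spanning (v i))) (λ k → E k j))))
    span-at v j with i ≟ j
    ... | yes refl = proj₂ (spanning (v i))
    ... | no  _    = V.≈ᴹ-refl j

    -- The index j is kept apart from i because matching on i ≟ i would need K.
    independent-at : ∀ x j → i ≡ j →
      FixedAt j (V._+ᴹ_ j (linearCombination (V j) x (λ k → E k j)) (V.-ᴹ_ j (V.0ᴹ j))) →
      ∀ k → x k K.≈ K.0#
    independent-at x j i≡j fixed with i ≟ j
    ... | yes refl = independent x fixed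
    ... | no  i≢j  = ⊥-elim (i≢j i≡j)

  injectAutomorphism-ε : ∀ i → GLΠ.ε GLΠ.≈ injectAutomorphism i (GL.ε i)
  injectAutomorphism-ε i v j with i ≟ j
  ... | yes refl = V.≈ᴹ-refl j
  ... | no  _    = V.≈ᴹ-refl j

  injectAutomorphism-∙ : ∀ i g h →
    (injectAutomorphism i g GLΠ.∙ injectAutomorphism i h) GLΠ.≈ injectAutomorphism i (GL._∙_ i g h)
  injectAutomorphism-∙ i g h v j with i ≟ j
  ... | yes refl = V.≈ᴹ-refl j
  ... | no  _    = V.≈ᴹ-refl j

  -- Inverses are read off from surjectivity, whose witnesses for a product automorphism are chosen
  -- componentwise.
  injectAutomorphism-⁻¹ : ∀ i g →
    (injectAutomorphism i g GLΠ.⁻¹) GLΠ.≈ injectAutomorphism i (GL._⁻¹ i g)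
  injectAutomorphism-⁻¹ i g v j with i ≟ j
  ... | yes refl = V.≈ᴹ-refl j
  ... | no  _    = V.≈ᴹ-refl j

  injectAutomorphism-cong : ∀ i {g h} → GL._≈_ i g h → injectAutomorphism i g GLΠ.≈ injectAutomorphism i h
  injectAutomorphism-cong i g≈h v j with i ≟ j
  ... | yes refl = g≈h (v j)
  ... | no  _    = V.≈ᴹ-refl j

  injectAutomorphism-generated : ∀ i {S : Pred (GL.Carrier i) p} {T : Pred GLΠ.Carrier q} →
    (∀ {g} → g ∈ S → injectAutomorphism i g ∈ T) →
    ∀ {g} → g ∈ Generated (GL (V i)) S → injectAutomorphism i g ∈ Generated (GL (productSpace V)) T
  injectAutomorphism-generated i {S = S} {T = T} S⇒T = go
    where
    go : ∀ {g} → g ∈ Generated (GL (V i)) S → injectAutomorphism i g ∈ Generated (GL (productSpace V)) T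
    go (gen g∈S)            = gen (S⇒T g∈S)
    go one                  = resp (injectAutomorphism-ε i) one
    go (mul {g} {h} g∈ h∈)  = resp (injectAutomorphism-∙ i g h) (mul (go g∈) (go h∈))
    go (inv {g} g∈)         = resp (injectAutomorphism-⁻¹ i g) (inv (go g∈))
    go (resp {g} {h} g≈h g∈) = resp (injectAutomorphism-cong i {g} {h} g≈h) (go g∈)

  -- In each component one of the two factors is the identity.
  splitFactor : ∀ i h →
    (injectAutomorphism i (h i) GLΠ.∙ productAutomorphism V (replace h i (GL.ε i)))
      GLΠ.≈ productAutomorphism V h
  splitFactor i h v j with i ≟ j
  ... | yes refl = V.≈ᴹ-refl j
  ... | no  _    = V.≈ᴹ-refl j

  module _ {S : ∀ i → Pred (GL.Carrier i) p} {T : Pred GLΠ.Carrier q}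
    (S⇒T : ∀ i {g} → g ∈ S i → injectAutomorphism i g ∈ T) where

    private
      -- Induction on a list containing every index where `h` may be nontrivial: splitting off the
      -- factor at the head resets that entry to the identity, which leaves the tail as such a list.
      supported : (is : List (Fin r)) (h : ∀ i → GL.Carrier i) →
        (∀ j → j ∉ is → GL._≈_ j (h j) (GL.ε j)) →
        (∀ i → h i ∈ Generated (GL (V i)) (S i)) →
        productAutomorphism V h ∈ Generated (GL (productSpace V)) T
      supported []       h trivial h∈ =
        resp (λ v j → V.≈ᴹ-sym j (trivial j (λ ()) (v j))) one
      supported (i ∷ is) h trivial h∈ = resp (splitFactor i h)
        (mul (injectAutomorphism-generated i (S⇒T i) (h∈ i))
             (supported is (replace h i (GL.ε i)) trivial′
               (replace-all (λ j → Generated (GL (V j)) (S j)) i h∈ one)))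
        where
        trivial′ : ∀ j → j ∉ is → GL._≈_ j (replace h i (GL.ε i) j) (GL.ε j)
        trivial′ j j∉is with i ≟ j
        ... | yes refl = λ v → V.≈ᴹ-refl j
        ... | no  i≢j  = trivial j λ { (here j≡i) → i≢j (sym j≡i) ; (there j∈is) → j∉is j∈is }

    productAutomorphism-generated : (h : ∀ i → GL.Carrier i) →
      (∀ i → h i ∈ Generated (GL (V i)) (S i)) →
      productAutomorphism V h ∈ Generated (GL (productSpace V)) T
    productAutomorphism-generated h =
      -- No index lies outside `allFin r`, so the triviality condition is vacuous.
      supported (allFin r) h (λ j j∉ → ⊥-elim (j∉ (∈-allFin j)))

  module _ (G : (i : Fin r) → LinearGroup (V i) p) (Q : Pred ℕ q) where

    -- Membership holds because every other `G j` contains the identity, and the codimension `n` is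
    -- unchanged, so any `Q` carries over.
    injectAutomorphism-generator : ∀ i {g} → g ∈ codimensionGenerators (V i) (G i) Q →
      injectAutomorphism i g ∈ codimensionGenerators (productSpace V) (productGroup V G) Q
    injectAutomorphism-generator i {g} (g∈G , n , codim , n∈Q) =
      ( replace GL.ε i g
      , replace-all (λ j → Subgroup.Member (G j)) i (λ j → Subgroup.ε-closed (G j)) g∈G
      , GLΠ.refl {injectAutomorphism i g} )
      , n , injectAutomorphism-codimension i g codim , n∈Q

    productGroup-generated :
      (∀ i → Subgroup.Member (G i) ⊆ Generated (GL (V i)) (codimensionGenerators (V i) (G i) Q)) →
      Subgroup.Member (productGroup V G) ⊆
        Generated (GL (productSpace V)) (codimensionGenerators (productSpace V) (productGroup V G) Q)
    productGroup-generated G⊆ {g} (h , h∈G , g≈h) =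
      resp (GLΠ.sym {g} {productAutomorphism V h} g≈h)
        (productAutomorphism-generated injectAutomorphism-generator h (λ i → G⊆ i (h∈G i)))

proposition2p8 : ∀ {m ℓ p : Level} {r : ℕ} (V : Fin r → RealVectorSpace m ℓ) → (∀ i → FiniteDimensional (V i)) →
    (G : (i : Fin r) → LinearGroup (V i) p) → (∀ i → Finite (GL (V i)) (G i)) →
    (k : ℤ) →
    ((∀ i → GeneratedInCodimension (V i) k (G i)) → GeneratedInCodimension (productSpace V) k (productGroup V G)) ×
    ((∀ i → StrictlyGeneratedInCodimension (V i) k (G i)) → StrictlyGeneratedInCodimension (productSpace V) k (productGroup V G))
proposition2p8 V _ G _ k =
    -- The two claims differ only in `Q`. The second inclusion is immediate, since a generator
    -- carries its membership in the product group as first component.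
    (λ gens → productGroup-generated V G (λ n → ℤ.+ n ℤ.≤ k) (λ i → proj₁ (gens i))
            , Generated⊆Subgroup (GL (productSpace V)) (productGroup V G) proj₁)
  , (λ gens → productGroup-generated V G (λ n → ℤ.+ n ≡ k) (λ i → proj₁ (gens i))
            , Generated⊆Subgroup (GL (productSpace V)) (productGroup V G) proj₁)
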